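{- Let $u \ge n$. For any $s = \Omega(n)$, there is a non-adaptive static cell probe data structure for the dictionary problem, storing $n$ key-value pairs $(x_i,y_i) \in [u]\times[u]$ using $s$ memory cells of $w = \Theta(\lg u)$ bits and answering queries in $$t = O\left(\frac{\lg(u/n)}{\lg(s/n)}\right)$$ probes.
   Context: Here $[m] = \{0,\dots,m-1\}$ and $\lg$ is the base-2 logarithm. The asymptotic notation $\Omega, \Theta, O$ hides absolute constants; "for any $s=\Omega(n)$" means for any $s$ at least a sufficiently large absolute constant times $n$. Dictionary problem: the input is a set $X$ of $n$ key-value pairs from $[u]\times[u]$ such that each key $x$ occurs in at most one pair. On query $x\in[u]$, the data structure must return the value $y$ with $(x,y)\in X$, or report that no such $y$ exists. Cell probe model (static, deterministic): for each input $X$, the data structure stores a memory of $s$ cells with addresses $0,\dots,s-1$, each containing $w$ bits (an arbitrary function of $X$). A query $x$ is answered by probing (reading) cells; the answer must be correct for every input and every query. Computation is free, and the query time $t$ is the maximum number of cells probed. The parameters $n,u,s,w$ and any fixed function of them are known to the query algorithm at no cost. The data structure is non-adaptive if the set of addresses probed on query $x$ depends only on $x$ (not on $X$ or on the contents of cells); the answer is then a function of $x$ and the contents of the probed cells.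
   Formalization: The probe bound is read as t ≤ max(1, C·lg(u/n)/lg(s/n)), with n ≥ 1: the literal bound fails when the ratio is near 0 (for u = n ≥ 2 it is 0, yet at least one probe is needed). -}

module Defs where

open import Data.Bool using (Bool)
open import Data.Fin using (Fin; combine)
open import Data.Fin.Subset using (Subset; _∈_; _∉_; ∣_∣)
open import Data.Integer using (+_; -[1+_])
open import Data.Maybe using (Maybe; just; nothing)
open import Data.Nat using (ℕ; suc; _*_; _^_; _≤_)
open import Data.Product using (∃-syntax; _×_)
open import Data.Rational.Unnormalised as ℚᵘ using (ℚᵘ; mkℚᵘ; 0ℚᵘ)
open import Data.Vec using (Vec; lookup; map)
open import Relation.Binary.PropositionalEquality using (_≡_)

infix  4 _≼_
infixl 7 _·_ _÷_

-- A real number x is represented by its closed lower cut { r : r ≤ x }.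
ℝ : Set₁
ℝ = ℚᵘ → Set

_≼_ : ℝ → ℝ → Set
x ≼ y = ∀ r → x r → y r

fromℕ : ℕ → ℝ
fromℕ k r = r ℚᵘ.≤ (+ k) ℚᵘ./ 1

_·_ : ℕ → ℝ → ℝ
(c · x) r = ∃[ q ] x q × r ℚᵘ.≤ ((+ c) ℚᵘ./ 1) ℚᵘ.* q

-- Intended for x ≥ 0 and y > 0: then r ≤ x / y iff r * y ≤ x, and only
-- nonnegative lower bounds q of y matter (for r < 0 both sides hold).
_÷_ : ℝ → ℝ → ℝ
(x ÷ y) r = ∀ q → 0ℚᵘ ℚᵘ.≤ q → y q → x (r ℚᵘ.* q)

-- The base-2 logarithm of k / m, for k, m > 0.  With b = suc d,
-- a / b ≤ lg (k / m) iff 2 ^ a ≤ (k / m) ^ b; note that mkℚᵘ stores b - 1.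
lg[_/_] : ℕ → ℕ → ℝ
lg[ k / m ] (mkℚᵘ (+ a)    d) = 2 ^ a * m ^ suc d ≤ k ^ suc d
lg[ k / m ] (mkℚᵘ -[1+ a ] d) = m ^ suc d ≤ 2 ^ suc a * k ^ suc d

-- Subsets of [u] × [u] are taken along the bijection
-- combine : Fin u → Fin u → Fin (u * u).
record Input (n u : ℕ) : Set where
  field
    pairs      : Subset (u * u)
    size       : ∣ pairs ∣ ≡ n
    functional : ∀ (x y y′ : Fin u) → combine x y ∈ pairs → combine x y′ ∈ pairs → y ≡ y′

open Input public

IsAnswer : ∀ {n u} → Input n u → Fin u → Maybe (Fin u) → Set
IsAnswer X x (just y) = combine x y ∈ pairs X
IsAnswer X x nothing  = ∀ y → combine x y ∉ pairs X

Memory : (s w : ℕ) → Set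
Memory s w = Vec (Vec Bool w) s

-- Addresses in `probes x` may repeat, so at most t distinct cells are read.
record NonAdaptiveDictionary (n u s w t : ℕ) : Set where
  field
    store   : Input n u → Memory s w
    probes  : Fin u → Vec (Fin s) t
    answer  : Fin u → Vec (Vec Bool w) t → Maybe (Fin u)
    correct : ∀ X x → IsAnswer X x (answer x (map (lookup (store X)) (probes x)))

{-# OPTIONS --safe #-}
-- Every cell holds at most one key-value pair, and a query x reads the cells
-- f x, so a static assignment f works as soon as every set of n keys can be
-- matched into cells.  If u ≤ s, take f x = { x }.  Otherwise choose t random
-- cells for every key.  By Hall's theorem, matchings exist unless, for some set
-- T of j < n cells, more than j keys x have f x ⊆ T.  The union bound over T is at most
--   Σⱼ C(s,j) C(u,j+1) (j/s)^(t(j+1)) ≤ Σⱼ (16 (u/j) (j/s)^(t-1))^(j+1),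
-- which is below 1 once 32 u n^(t-2) ≤ s^(t-1); the least such t ≥ 2 is
-- O(lg (u/n) / lg (s/n)) because s ≤ u.  The random choice is derandomised by
-- the method of conditional expectations.
module Submission where

open import Data.Bool as Bool using (Bool; true; false; _∧_; if_then_else_)
open import Data.Fin using (Fin; zero; suc; _≟_; combine; fromℕ<; inject≤; quotient; remainder; toℕ)
open import Data.Fin.Properties using (2↔Bool; any?; combine-injective; combine-remQuot; fromℕ<-cong; fromℕ<-toℕ; inject≤-injective; toℕ-inject≤; toℕ<n)
  renaming (suc-injective to sucFin-injective)
open import Data.Fin.Subset using (Subset; inside; outside; ∣_∣; _∪_; _∩_; _-_; ⁅_⁆; ⊥; ⊤; _⊆_)
  renaming (_∈_ to _∈ˢ_; _∉_ to _∉ˢ_)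
import Data.Fin.Subset.Properties as S
open import Data.Integer as ℤ using (-[1+_]) renaming (+_ to pos)
import Data.Integer.Properties as ℤ
open import Data.List using (List; []; _∷_; _++_; map; length; filter; allFin; cartesianProductWith)
open import Data.List.Membership.Propositional using () renaming (_∈_ to _∈ˡ_)
open import Data.List.Membership.Propositional.Properties using (∈-++⁺ˡ; ∈-++⁺ʳ; ∈-map⁺; ∈-filter⁺; ∈-allFin)
import Data.List.Properties as List
open import Data.List.Relation.Unary.All as All using (All; []; _∷_)
import Data.List.Relation.Unary.All.Properties as All
open import Data.List.Relation.Unary.Any using (here)
open import Data.Maybe using (Maybe; just; nothing)
open import Data.Nat hiding (_≟_)
open import Data.Nat.ListAction using (sum)
open import Data.Nat.ListAction.Properties using (sum-++)
open import Data.Nat.Properties hiding (_≟_)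
open import Data.Nat.Tactic.RingSolver using (solve-∀)
open import Data.Product using (∃; ∃-syntax; _×_; _,_; proj₁; proj₂)
open import Data.Rational.Unnormalised as ℚᵘ using (mkℚᵘ)
import Data.Rational.Unnormalised.Properties as ℚᵘ
open import Data.Sum using (_⊎_; inj₁; inj₂)
open import Data.Vec as Vec using (Vec; []; _∷_; here; there; lookup; tabulate)
open import Data.Vec.Membership.Propositional using (_∈_)
open import Data.Vec.Properties as Vec using ([]=⇒lookup; lookup⇒[]=; lookup-++ˡ; lookup-++ʳ; lookup∘tabulate)
open import Data.Vec.Relation.Unary.Any using (here; there)
open import Function using (Injection; Inverse; _∘_)
open import Function.Properties.Inverse using (↔⇒↣)
open import Relation.Binary.PropositionalEquality
open import Relation.Nullary using (Dec; yes; no; does; ¬_; contradiction)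
open import Relation.Unary using (Decidable)
open import Defs

private
  variable
    A B : Set

-- Arithmetic

^-distribʳ : ∀ m n k → (m * n) ^ k ≡ m ^ k * n ^ k
^-distribʳ m n zero    = refl
^-distribʳ m n (suc k) = trans (cong (m * n *_) (^-distribʳ m n k)) (swap m n (m ^ k) (n ^ k))
  where
  swap : ∀ a b c d → a * b * (c * d) ≡ a * c * (b * d)
  swap = solve-∀

m^d*m!≤[m+d]! : ∀ m d → m ^ d * m ! ≤ (d + m) !
m^d*m!≤[m+d]! m zero    = ≤-reflexive (+-identityʳ (m !))
m^d*m!≤[m+d]! m (suc d) = begin
  m * m ^ d * m !          ≡⟨ *-assoc m (m ^ d) (m !) ⟩
  m * (m ^ d * m !)        ≤⟨ *-mono-≤ (m≤n+m m (suc d)) (m^d*m!≤[m+d]! m d) ⟩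
  suc (d + m) * (d + m) !  ∎
  where open ≤-Reasoning

-- A binomial coefficient is at most `2 ^ (m + n)`, cleared of division. The induction is Pascal's
-- rule, obtained by splitting the leading factor of the factorial.
[m+n]!≤2^[m+n]*m!*n! : ∀ m n → (m + n) ! ≤ 2 ^ (m + n) * (m ! * n !)
[m+n]!≤2^[m+n]*m!*n! zero n = begin
  n !                    ≤⟨ m≤n*m (n !) (2 ^ n) ⦃ m^n≢0 2 n ⦄ ⟩
  2 ^ n * n !            ≡⟨ cong (2 ^ n *_) (+-identityʳ (n !)) ⟨
  2 ^ n * (1 * n !)      ∎
  where open ≤-Reasoning
[m+n]!≤2^[m+n]*m!*n! (suc m) zero = begin
  (suc m + 0) !                      ≡⟨ cong _! (+-identityʳ (suc m)) ⟩
  suc m !                            ≤⟨ m≤n*m (suc m !) (2 ^ (suc m + 0)) ⦃ m^n≢0 2 (suc m + 0) ⦄ ⟩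
  2 ^ (suc m + 0) * suc m !          ≡⟨ cong (2 ^ (suc m + 0) *_) (*-identityʳ (suc m !)) ⟨
  2 ^ (suc m + 0) * (suc m ! * 1)    ∎
  where open ≤-Reasoning
[m+n]!≤2^[m+n]*m!*n! (suc m) (suc n) = begin
  (suc m + suc n) * (m + suc n) !
    ≡⟨ *-distribʳ-+ ((m + suc n) !) (suc m) (suc n) ⟩
  suc m * (m + suc n) ! + suc n * (m + suc n) !
    ≡⟨ cong (λ k → suc m * (m + suc n) ! + suc n * k !) (+-suc m n) ⟩
  suc m * (m + suc n) ! + suc n * (suc m + n) !
    ≤⟨ +-mono-≤ (*-monoʳ-≤ (suc m) ([m+n]!≤2^[m+n]*m!*n! m (suc n)))
                (*-monoʳ-≤ (suc n) ([m+n]!≤2^[m+n]*m!*n! (suc m) n)) ⟩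
  suc m * (2 ^ (m + suc n) * (m ! * suc n !)) + suc n * (2 ^ (suc m + n) * (suc m ! * n !))
    ≡⟨ cong (λ k → suc m * (2 ^ (m + suc n) * (m ! * suc n !)) + suc n * (2 ^ k * (suc m ! * n !))) (+-suc m n) ⟨
  suc m * (2 ^ (m + suc n) * (m ! * suc n !)) + suc n * (2 ^ (m + suc n) * (suc m ! * n !))
    ≡⟨ collect (suc m) (suc n) (2 ^ (m + suc n)) (m !) (n !) ⟩
  2 ^ (suc m + suc n) * (suc m ! * suc n !)   ∎
  where
  open ≤-Reasoning
  collect : ∀ x y p a b → x * (p * (a * (y * b))) + y * (p * (x * a * b)) ≡ 2 * p * (x * a * (y * b))
  collect = solve-∀

-- A substitute for Stirling's formula, using that the central binomial coefficient is at most
-- `4 ^ n`.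
n^n≤4^n*n! : ∀ n → n ^ n ≤ 4 ^ n * n !
n^n≤4^n*n! n = *-cancelʳ-≤ _ _ (n !) ⦃ n !≢0 ⦄ (begin
  n ^ n * n !               ≤⟨ m^d*m!≤[m+d]! n n ⟩
  (n + n) !                 ≤⟨ [m+n]!≤2^[m+n]*m!*n! n n ⟩
  2 ^ (n + n) * (n ! * n !) ≡⟨ cong (_* (n ! * n !)) (trans (^-distribˡ-+-* 2 n n) (sym (^-distribʳ 2 2 n))) ⟩
  4 ^ n * (n ! * n !)       ≡⟨ *-assoc (4 ^ n) (n !) (n !) ⟨
  4 ^ n * n ! * n !         ∎)
  where open ≤-Reasoning

-- In closed form C(m,d) a^d N^(m-d), and zero for m < d: the union bound over the sets of d trials
-- that all succeed. A trial outside the set has weight `N`, not `N - a`, so the value overcounts.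
tail : (N a m d : ℕ) → ℕ
tail N a m       zero    = N ^ m
tail N a zero    (suc d) = 0
tail N a (suc m) (suc d) = a * tail N a m d + N * tail N a m (suc d)

-- The left side consists of the two leading terms of the binomial expansion of the right side.
^-suc-bound : ∀ m d → suc d * m ^ d + m ^ suc d ≤ suc m ^ suc d
^-suc-bound m zero    = ≤-reflexive (lem m)
  where
  lem : ∀ m → 1 * 1 + m * 1 ≡ suc m * 1
  lem = solve-∀
^-suc-bound m (suc d) = begin
  suc (suc d) * (m * m ^ d) + m * (m * m ^ d)                  ≤⟨ m≤m+n _ (suc d * m ^ d) ⟩
  suc (suc d) * (m * m ^ d) + m * (m * m ^ d) + suc d * m ^ d  ≡⟨ lem m d (m ^ d) ⟩
  suc m * (suc d * m ^ d + m ^ suc d)                          ≤⟨ *-monoʳ-≤ (suc m) (^-suc-bound m d) ⟩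
  suc m * suc m ^ suc d                                        ∎
  where
  open ≤-Reasoning
  lem : ∀ m d p → suc (suc d) * (m * p) + m * (m * p) + suc d * p ≡ suc m * (suc d * p + m * p)
  lem = solve-∀

-- In terms of the closed form of `tail` this is C(m,d) d! ≤ m^d. The two summands of the recursion
-- recombine through `^-suc-bound`.
tail-bound : ∀ N a m d → tail N a m d * (d ! * N ^ d) ≤ (m * a) ^ d * N ^ m
tail-bound N a m zero = ≤-reflexive (lem (N ^ m))
  where
  lem : ∀ p → p * (1 * 1) ≡ 1 * p
  lem = solve-∀
tail-bound N a zero (suc d) = z≤n
tail-bound N a (suc m) (suc d) = begin
  (a * tail N a m d + N * tail N a m (suc d)) * (suc d * d ! * (N * N ^ d))
    ≡⟨ expand a N (tail N a m d) (tail N a m (suc d)) (suc d) (d !) (N ^ d) ⟩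
  suc d * a * N * (tail N a m d * (d ! * N ^ d)) + N * (tail N a m (suc d) * (suc d * d ! * (N * N ^ d)))
    ≤⟨ +-mono-≤ (*-monoʳ-≤ (suc d * a * N) (tail-bound N a m d)) (*-monoʳ-≤ N (tail-bound N a m (suc d))) ⟩
  suc d * a * N * ((m * a) ^ d * N ^ m) + N * ((m * a) ^ suc d * N ^ m)
    ≡⟨ cong₂ (λ p q → suc d * a * N * (p * N ^ m) + N * (q * N ^ m)) (^-distribʳ m a d) (^-distribʳ m a (suc d)) ⟩
  suc d * a * N * (m ^ d * a ^ d * N ^ m) + N * (m * m ^ d * (a * a ^ d) * N ^ m)
    ≡⟨ collect a N (N ^ m) m (m ^ d) (a ^ d) (suc d) ⟩
  (suc d * m ^ d + m ^ suc d) * a ^ suc d * N ^ suc m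
    ≤⟨ *-monoˡ-≤ (N ^ suc m) (*-monoˡ-≤ (a ^ suc d) (^-suc-bound m d)) ⟩
  suc m ^ suc d * a ^ suc d * N ^ suc m
    ≡⟨ cong (_* N ^ suc m) (^-distribʳ (suc m) a (suc d)) ⟨
  (suc m * a) ^ suc d * N ^ suc m ∎
  where
  open ≤-Reasoning
  expand : ∀ a N t₀ t₁ e f p → (a * t₀ + N * t₁) * (e * f * (N * p)) ≡ e * a * N * (t₀ * (f * p)) + N * (t₁ * (e * f * (N * p)))
  expand = solve-∀
  collect : ∀ a N M m p q e → e * a * N * (p * q * M) + N * (m * p * (a * q) * M) ≡ (e * p + m * p) * (a * q) * (N * M)
  collect = solve-∀

-- Finite sums and the method of conditional expectations

∑ : List A → (A → ℕ) → ℕ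
∑ xs f = sum (map f xs)

∑-mono : ∀ (xs : List A) {f g} → (∀ x → f x ≤ g x) → ∑ xs f ≤ ∑ xs g
∑-mono []       f≤g = z≤n
∑-mono (x ∷ xs) f≤g = +-mono-≤ (f≤g x) (∑-mono xs f≤g)

∑-cong : ∀ (xs : List A) {f g} → (∀ x → f x ≡ g x) → ∑ xs f ≡ ∑ xs g
∑-cong xs f≡g = cong sum (List.map-cong f≡g xs)

∑-+ : ∀ (xs : List A) f g → ∑ xs (λ x → f x + g x) ≡ ∑ xs f + ∑ xs g
∑-+ []       f g = refl
∑-+ (x ∷ xs) f g = trans (cong (f x + g x +_) (∑-+ xs f g)) (swap (f x) (g x) (∑ xs f) (∑ xs g))
  where
  swap : ∀ a b c d → a + b + (c + d) ≡ a + c + (b + d)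
  swap = solve-∀

∑-*ʳ : ∀ (xs : List A) f c → ∑ xs (λ x → f x * c) ≡ ∑ xs f * c
∑-*ʳ []       f c = refl
∑-*ʳ (x ∷ xs) f c = trans (cong (f x * c +_) (∑-*ʳ xs f c)) (sym (*-distribʳ-+ c (f x) (∑ xs f)))

∑-const : ∀ {xs : List A} {f c} → All (λ x → f x ≡ c) xs → ∑ xs f ≡ length xs * c
∑-const []          = refl
∑-const (fx≡c ∷ ps) = cong₂ _+_ fx≡c (∑-const ps)

∑-swap : ∀ (xs : List A) (ys : List B) (f : A → B → ℕ) → ∑ xs (λ x → ∑ ys (f x)) ≡ ∑ ys (λ y → ∑ xs (λ x → f x y))
∑-swap []       ys f = sym (trans (∑-const (All.universal (λ _ → refl) ys)) (*-zeroʳ (length ys)))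
∑-swap (x ∷ xs) ys f = trans (cong (∑ ys (f x) +_) (∑-swap xs ys f)) (sym (∑-+ ys (f x) _))

∑-++ : ∀ (xs ys : List A) f → ∑ (xs ++ ys) f ≡ ∑ xs f + ∑ ys f
∑-++ xs ys f = trans (cong sum (List.map-++ f xs ys)) (sum-++ (map f xs) (map f ys))

∑-map : ∀ (g : A → B) xs f → ∑ (map g xs) f ≡ ∑ xs (f ∘ g)
∑-map g xs f = cong sum (sym (List.map-∘ xs))

∑-cartesianProductWith : ∀ {C : Set} (g : A → B → C) xs ys f →
  ∑ (cartesianProductWith g xs ys) f ≡ ∑ xs (λ x → ∑ ys (λ y → f (g x y)))
∑-cartesianProductWith g []       ys f = refl
∑-cartesianProductWith g (x ∷ xs) ys f = trans
  (∑-++ (map (g x) ys) (cartesianProductWith g xs ys) f)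
  (cong₂ _+_ (∑-map (g x) ys f) (∑-cartesianProductWith g xs ys f))

∑-allFin-suc : ∀ n (f : Fin (suc n) → ℕ) → ∑ (allFin (suc n)) f ≡ f zero + ∑ (allFin n) (f ∘ suc)
∑-allFin-suc n f = cong (λ xs → f zero + sum xs)
  (trans (List.map-tabulate suc f) (sym (List.map-tabulate (λ i → i) (f ∘ suc))))

∑<⇒∃< : ∀ (xs : List A) f M → ∑ xs f < length xs * M → ∃ λ x → f x < M
∑<⇒∃< (x ∷ xs) f M ∑< with f x <? M
... | yes fx<M = x , fx<M
... | no  fx≮M = ∑<⇒∃< xs f M (+-cancelˡ-< M _ _ (≤-<-trans (+-monoˡ-≤ (∑ xs f) (≮⇒≥ fx≮M)) ∑<))

∑<⇒All< : ∀ (xs : List A) f {M} → ∑ xs f < M → All (λ x → f x < M) xs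
∑<⇒All< []       f ∑<M = []
∑<⇒All< (x ∷ xs) f ∑<M =
  ≤-<-trans (m≤m+n (f x) _) ∑<M ∷ ∑<⇒All< xs f (≤-<-trans (m≤n+m _ (f x)) ∑<M)

𝟙 : Bool → ℕ
𝟙 b = if b then 1 else 0

𝟙-∧ : ∀ a b → 𝟙 (a ∧ b) ≡ 𝟙 a * 𝟙 b
𝟙-∧ true  b = sym (*-identityˡ (𝟙 b))
𝟙-∧ false b = refl

-- tail N a m d / N ^ m bounds the probability that m independent uniform choices
-- meet an event of probability at most a / N at least d times; each choice is
-- made so that the sum of these bounds over all τ does not increase.
module _ (vs : List B) (P : A → B → Bool) (a : A → ℕ)
         (a-bound : ∀ τ → ∑ vs (𝟙 ∘ P τ) ≤ a τ) where

  private
    N = length vs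

  tail-step : ∀ τ m d → ∑ vs (λ v → tail N (a τ) m (d ∸ 𝟙 (P τ v))) ≤ tail N (a τ) (suc m) d
  tail-step τ m zero = ≤-reflexive (∑-const (All.universal (λ v → cong (tail N (a τ) m) (0∸n≡0 (𝟙 (P τ v)))) vs))
  tail-step τ m (suc d) = begin
    ∑ vs (λ v → tail N (a τ) m (suc d ∸ 𝟙 (P τ v)))
      -- On a hit the second summand is pure overcount; it accounts for the factor `N` in place of
      -- `N - a` in `tail`.
      ≤⟨ ∑-mono vs (λ v → split (P τ v)) ⟩
    ∑ vs (λ v → 𝟙 (P τ v) * tail N (a τ) m d + tail N (a τ) m (suc d))
      ≡⟨ ∑-+ vs _ _ ⟩
    ∑ vs (λ v → 𝟙 (P τ v) * tail N (a τ) m d) + ∑ vs (λ _ → tail N (a τ) m (suc d))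
      ≡⟨ cong₂ _+_ (∑-*ʳ vs (𝟙 ∘ P τ) _) (∑-const (All.universal (λ _ → refl) vs)) ⟩
    ∑ vs (𝟙 ∘ P τ) * tail N (a τ) m d + N * tail N (a τ) m (suc d)
      ≤⟨ +-monoˡ-≤ _ (*-monoˡ-≤ (tail N (a τ) m d) (a-bound τ)) ⟩
    tail N (a τ) (suc m) (suc d) ∎
    where
    open ≤-Reasoning
    split : ∀ b → tail N (a τ) m (suc d ∸ 𝟙 b) ≤ 𝟙 b * tail N (a τ) m d + tail N (a τ) m (suc d)
    split true  = ≤-trans (m≤m+n _ 0) (m≤m+n _ _)
    split false = ≤-refl

  derandomise : ∀ (τs : List A) m (d : A → ℕ) → ∑ τs (λ τ → tail N (a τ) m (d τ)) < N ^ m →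
    ∃ λ (f : Fin m → B) → All (λ τ → ∑ (allFin m) (λ i → 𝟙 (P τ (f i))) < d τ) τs
  -- With no trial left, `tail` is 1 for threshold zero and 0 otherwise, so a sum below 1 means that
  -- no threshold is used up.
  derandomise τs zero d small = (λ ()) , All.map positive (∑<⇒All< τs _ small)
    where
    positive : ∀ {τ} → tail N (a τ) 0 (d τ) < 1 → 0 < d τ
    positive {τ} p with d τ
    ... | zero  = contradiction p (<-irrefl refl)
    ... | suc _ = z<s
  derandomise τs (suc m) d small = f , All.map extend f′-good
    where
    average : ∑ vs (λ v → ∑ τs (λ τ → tail N (a τ) m (d τ ∸ 𝟙 (P τ v)))) < N * N ^ m
    average = ≤-<-trans
      (≤-trans (≤-reflexive (∑-swap vs τs _)) (∑-mono τs (λ τ → tail-step τ m (d τ))))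
      small

    v,small′ = ∑<⇒∃< vs _ _ average
    v = proj₁ v,small′
    -- A hit on `τ` uses up one unit of its threshold. A threshold at zero stays there and keeps its
    -- full weight `N ^ m`.
    f′,good = derandomise τs m (λ τ → d τ ∸ 𝟙 (P τ v)) (proj₂ v,small′)
    f′ = proj₁ f′,good
    f′-good = proj₂ f′,good

    f : Fin (suc m) → B
    f zero    = v
    f (suc i) = f′ i

    add : ∀ b {k e} → k < e ∸ 𝟙 b → 𝟙 b + k < e
    add false         k<e = k<e
    add true {e = suc e} k<e = s<s k<e

    extend : ∀ {τ} → ∑ (allFin m) (λ i → 𝟙 (P τ (f′ i))) < d τ ∸ 𝟙 (P τ v) →
             ∑ (allFin (suc m)) (λ i → 𝟙 (P τ (f i))) < d τ
    extend {τ} k<d = subst (_< d τ) (sym (∑-allFin-suc m (λ i → 𝟙 (P τ (f i))))) (add (P τ v) k<d)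

-- Counting tuples and subsets of cells

vecs : List A → ∀ t → List (Vec A t)
vecs xs zero    = [] ∷ []
vecs xs (suc t) = cartesianProductWith _∷_ xs (vecs xs t)

length≡∑1 : ∀ (xs : List A) → length xs ≡ ∑ xs (λ _ → 1)
length≡∑1 xs = sym (trans (∑-const (All.universal (λ _ → refl) xs)) (*-identityʳ (length xs)))

length-vecs : ∀ (xs : List A) t → length (vecs xs t) ≡ length xs ^ t
length-vecs xs zero    = refl
length-vecs xs (suc t) = begin
  length (vecs xs (suc t))              ≡⟨ length≡∑1 (vecs xs (suc t)) ⟩
  ∑ (vecs xs (suc t)) (λ _ → 1)         ≡⟨ ∑-cartesianProductWith _∷_ xs (vecs xs t) _ ⟩
  ∑ xs (λ _ → ∑ (vecs xs t) (λ _ → 1))  ≡⟨ ∑-const (All.universal (λ _ → sym (length≡∑1 (vecs xs t))) xs) ⟩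
  length xs * length (vecs xs t)        ≡⟨ cong (length xs *_) (length-vecs xs t) ⟩
  length xs ^ suc t                     ∎
  where open ≡-Reasoning

covers : ∀ {s t} → Subset s → Vec (Fin s) t → Bool
covers T []       = true
covers T (i ∷ is) = lookup T i ∧ covers T is

∑-lookup : ∀ {s} (T : Subset s) → ∑ (allFin s) (𝟙 ∘ lookup T) ≡ ∣ T ∣
∑-lookup []            = refl
∑-lookup (inside  ∷ T) = trans (∑-allFin-suc _ (𝟙 ∘ lookup (inside  ∷ T))) (cong suc (∑-lookup T))
∑-lookup (outside ∷ T) = trans (∑-allFin-suc _ (𝟙 ∘ lookup (outside ∷ T))) (∑-lookup T)

-- The coordinates are independent, so the sum factors. Divided by `s ^ t` it is the probability
-- that a random tuple of cells stays inside `T`.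
∑-covers : ∀ {s} (T : Subset s) t → ∑ (vecs (allFin s) t) (𝟙 ∘ covers T) ≡ ∣ T ∣ ^ t
∑-covers     T zero    = refl
∑-covers {s} T (suc t) = begin
  ∑ (vecs (allFin s) (suc t)) (𝟙 ∘ covers T)
    ≡⟨ ∑-cartesianProductWith _∷_ (allFin s) (vecs (allFin s) t) _ ⟩
  ∑ (allFin s) (λ i → ∑ (vecs (allFin s) t) (λ is → 𝟙 (lookup T i ∧ covers T is)))
    ≡⟨ ∑-cong (allFin s) (λ i → ∑-cong (vecs (allFin s) t) (λ is →
         trans (𝟙-∧ (lookup T i) (covers T is)) (*-comm (𝟙 (lookup T i)) _))) ⟩
  ∑ (allFin s) (λ i → ∑ (vecs (allFin s) t) (λ is → 𝟙 (covers T is) * 𝟙 (lookup T i)))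
    ≡⟨ ∑-cong (allFin s) (λ i → trans (∑-*ʳ (vecs (allFin s) t) _ _)
         (trans (cong (_* 𝟙 (lookup T i)) (∑-covers T t)) (*-comm (∣ T ∣ ^ t) _))) ⟩
  ∑ (allFin s) (λ i → 𝟙 (lookup T i) * ∣ T ∣ ^ t)
    ≡⟨ ∑-*ʳ (allFin s) (𝟙 ∘ lookup T) _ ⟩
  ∑ (allFin s) (𝟙 ∘ lookup T) * ∣ T ∣ ^ t
    ≡⟨ cong (_* ∣ T ∣ ^ t) (∑-lookup T) ⟩
  ∣ T ∣ ^ suc t ∎
  where open ≡-Reasoning

subsets : ∀ s → ℕ → List (Subset s)
subsets zero    zero    = [] ∷ []
subsets zero    (suc j) = []
subsets (suc s) zero    = map (outside ∷_) (subsets s zero)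
subsets (suc s) (suc j) = map (inside ∷_) (subsets s j) ++ map (outside ∷_) (subsets s (suc j))

-- For `N = a = 1` the recursion of `tail` is Pascal's rule, so `tail-bound` also bounds the number
-- of sets in the union bound.
length-subsets : ∀ s j → length (subsets s j) ≡ tail 1 1 s j
length-subsets zero    zero    = refl
length-subsets zero    (suc j) = refl
length-subsets (suc s) zero    =
  trans (List.length-map _ (subsets s zero)) (trans (length-subsets s zero) (sym (+-identityʳ _)))
length-subsets (suc s) (suc j) = begin
  length (subsets (suc s) (suc j))
    ≡⟨ List.length-++ (map (inside ∷_) (subsets s j)) ⟩
  length (map (inside ∷_) (subsets s j)) + length (map (outside ∷_) (subsets s (suc j)))
    ≡⟨ cong₂ _+_ (List.length-map _ (subsets s j)) (List.length-map _ (subsets s (suc j))) ⟩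
  length (subsets s j) + length (subsets s (suc j))
    ≡⟨ cong₂ _+_ (length-subsets s j) (length-subsets s (suc j)) ⟩
  tail 1 1 s j + tail 1 1 s (suc j)
    ≡⟨ cong₂ _+_ (+-identityʳ (tail 1 1 s j)) (+-identityʳ (tail 1 1 s (suc j))) ⟨
  tail 1 1 (suc s) (suc j) ∎
  where open ≡-Reasoning

subsets-size : ∀ s j → All (λ T → ∣ T ∣ ≡ j) (subsets s j)
subsets-size zero    zero    = refl ∷ []
subsets-size zero    (suc j) = []
subsets-size (suc s) zero    = All.map⁺ (subsets-size s zero)
subsets-size (suc s) (suc j) = All.++⁺
  (All.map⁺ (All.map (cong suc) (subsets-size s j))) (All.map⁺ (subsets-size s (suc j)))

∈-subsets : ∀ {s} (T : Subset s) j → ∣ T ∣ ≡ j → T ∈ˡ subsets s j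
∈-subsets []            zero    eq = here refl
∈-subsets (outside ∷ T) zero    eq = ∈-map⁺ _ (∈-subsets T zero eq)
∈-subsets (outside ∷ T) (suc j) eq = ∈-++⁺ʳ (map (inside ∷_) (subsets _ j)) (∈-map⁺ _ (∈-subsets T (suc j) eq))
∈-subsets (inside  ∷ T) (suc j) eq = ∈-++⁺ˡ (∈-map⁺ _ (∈-subsets T j (suc-injective eq)))

subsets< : ∀ s → ℕ → List (Subset s)
subsets< s zero    = []
subsets< s (suc n) = subsets< s n ++ subsets s n

∈-subsets< : ∀ {s} (T : Subset s) n → ∣ T ∣ < n → T ∈ˡ subsets< s n
∈-subsets< {s} T (suc n) ∣T∣<1+n with m≤n⇒m<n∨m≡n (s≤s⁻¹ ∣T∣<1+n)
... | inj₁ ∣T∣<n = ∈-++⁺ˡ (∈-subsets< T n ∣T∣<n)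
... | inj₂ ∣T∣≡n = ∈-++⁺ʳ (subsets< s n) (∈-subsets T n ∣T∣≡n)

-- The series 1/2 + 1/4 + ... falls short of 1 by `1 / 2 ^ n` after `n` terms. The summand `M` on
-- the left keeps this gap, which makes the bound strict for positive `M`.
∑-subsets< : ∀ s n (f : Subset s → ℕ) M → (∀ j → j < n → ∑ (subsets s j) f * 2 ^ suc j ≤ M) →
  ∑ (subsets< s n) f * 2 ^ n + M ≤ M * 2 ^ n
∑-subsets< s zero    f M _ = ≤-reflexive (sym (*-identityʳ M))
∑-subsets< s (suc n) f M each = begin
  ∑ (subsets< s n ++ subsets s n) f * 2 ^ suc n + M
    ≡⟨ cong (λ k → k * 2 ^ suc n + M) (∑-++ (subsets< s n) (subsets s n) f) ⟩
  (∑ (subsets< s n) f + ∑ (subsets s n) f) * 2 ^ suc n + M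
    ≡⟨ rearrange (∑ (subsets< s n) f) (∑ (subsets s n) f) (2 ^ n) M ⟩
  2 * (∑ (subsets< s n) f * 2 ^ n) + M + ∑ (subsets s n) f * 2 ^ suc n
    ≤⟨ +-monoʳ-≤ (2 * (∑ (subsets< s n) f * 2 ^ n) + M) (each n ≤-refl) ⟩
  2 * (∑ (subsets< s n) f * 2 ^ n) + M + M
    ≡⟨ double (∑ (subsets< s n) f * 2 ^ n) M ⟩
  2 * (∑ (subsets< s n) f * 2 ^ n + M)
    ≤⟨ *-monoʳ-≤ 2 (∑-subsets< s n f M (λ j j<n → each j (m<n⇒m<1+n j<n))) ⟩
  2 * (M * 2 ^ n)
    ≡⟨ swap M (2 ^ n) ⟩
  M * 2 ^ suc n ∎
  where
  open ≤-Reasoning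
  rearrange : ∀ a b p M → (a + b) * (2 * p) + M ≡ 2 * (a * p) + M + b * (2 * p)
  rearrange = solve-∀
  double : ∀ a M → 2 * a + M + M ≡ 2 * (a + M)
  double = solve-∀
  swap : ∀ M p → 2 * (M * p) ≡ M * (2 * p)
  swap = solve-∀

-- Hall's theorem

∣p∪q∣+∣p∩q∣ : ∀ {n} (p q : Subset n) → ∣ p ∪ q ∣ + ∣ p ∩ q ∣ ≡ ∣ p ∣ + ∣ q ∣
∣p∪q∣+∣p∩q∣ []            []            = refl
∣p∪q∣+∣p∩q∣ (inside  ∷ p) (inside  ∷ q) =
  trans (cong suc (+-suc _ _)) (trans (cong (2 +_) (∣p∪q∣+∣p∩q∣ p q)) (cong suc (sym (+-suc _ _))))
∣p∪q∣+∣p∩q∣ (inside  ∷ p) (outside ∷ q) = cong suc (∣p∪q∣+∣p∩q∣ p q)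
∣p∪q∣+∣p∩q∣ (outside ∷ p) (inside  ∷ q) = trans (cong suc (∣p∪q∣+∣p∩q∣ p q)) (sym (+-suc _ _))
∣p∪q∣+∣p∩q∣ (outside ∷ p) (outside ∷ q) = ∣p∪q∣+∣p∩q∣ p q

x∉p-x : ∀ {n} (p : Subset n) x → x ∉ˢ p - x
x∉p-x (a ∷ p) (suc x) (there x∈) = x∉p-x p x x∈

covers⇒∈ : ∀ {s t} {T : Subset s} {is : Vec (Fin s) t} → covers T is ≡ true → ∀ {i} → i ∈ is → i ∈ˢ T
covers⇒∈ {T = T} {i ∷ is} c i∈ with lookup T i in eq
covers⇒∈ {T = T} {i ∷ is} c (here refl) | true = lookup⇒[]= i T eq
covers⇒∈ {T = T} {i ∷ is} c (there i∈) | true = covers⇒∈ c i∈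

∈⇒covers : ∀ {s t} {T : Subset s} {is : Vec (Fin s) t} → (∀ {i} → i ∈ is → i ∈ˢ T) → covers T is ≡ true
∈⇒covers {is = []}     _   = refl
∈⇒covers {is = i ∷ is} is⊆T rewrite []=⇒lookup (is⊆T (here refl)) = ∈⇒covers (is⊆T ∘ there)

covers-mono : ∀ {s t} {T T′ : Subset s} → T ⊆ T′ → (is : Vec (Fin s) t) → covers T is ≡ true → covers T′ is ≡ true
covers-mono T⊆T′ is c = ∈⇒covers (λ i∈ → T⊆T′ (covers⇒∈ {is = is} c i∈))

covers-∩ : ∀ {s t} (T T′ : Subset s) (is : Vec (Fin s) t) →
  covers T is ≡ true → covers T′ is ≡ true → covers (T ∩ T′) is ≡ true
covers-∩ T T′ is c c′ = ∈⇒covers (λ i∈ → S.x∈p∩q⁺ (covers⇒∈ {is = is} c i∈ , covers⇒∈ {is = is} c′ i∈))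

𝟙-supermodular : ∀ a b {u i} → (a ≡ true → u ≡ true) → (b ≡ true → u ≡ true) →
  (a ≡ true → b ≡ true → i ≡ true) → 𝟙 a + 𝟙 b ≤ 𝟙 u + 𝟙 i
𝟙-supermodular true  true  a⇒u b⇒u ab⇒i rewrite a⇒u refl | ab⇒i refl refl = ≤-refl
𝟙-supermodular true  false a⇒u b⇒u ab⇒i rewrite a⇒u refl = s≤s z≤n
𝟙-supermodular false true  a⇒u b⇒u ab⇒i rewrite b⇒u refl = s≤s z≤n
𝟙-supermodular false false a⇒u b⇒u ab⇒i = z≤n

-- A cell is assigned to the first key so that Hall's condition survives; every
-- cell that cannot be used lies in a tight set, and tight sets are closed under
-- union, so if no cell of the key were usable, a tight set would contain them
-- all and Hall's condition would already fail.
module Hall {K : Set} {s t : ℕ} (N : K → Vec (Fin s) t) where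

  confined : List K → Subset s → ℕ
  confined ks T = ∑ ks (λ k → 𝟙 (covers T (N k)))

  -- A key confined to either set is confined to the union, and a key confined to both is confined
  -- to the intersection.
  confined-supermodular : ∀ ks T T′ → confined ks T + confined ks T′ ≤ confined ks (T ∪ T′) + confined ks (T ∩ T′)
  confined-supermodular ks T T′ = begin
    confined ks T + confined ks T′
      ≡⟨ ∑-+ ks _ _ ⟨
    ∑ ks (λ k → 𝟙 (covers T (N k)) + 𝟙 (covers T′ (N k)))
      ≤⟨ ∑-mono ks (λ k → 𝟙-supermodular (covers T (N k)) (covers T′ (N k))
           (covers-mono (S.p⊆p∪q T′) (N k)) (covers-mono (S.q⊆p∪q T T′) (N k)) (covers-∩ T T′ (N k))) ⟩
    ∑ ks (λ k → 𝟙 (covers (T ∪ T′) (N k)) + 𝟙 (covers (T ∩ T′) (N k)))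
      ≡⟨ ∑-+ ks _ _ ⟩
    confined ks (T ∪ T′) + confined ks (T ∩ T′) ∎
    where open ≤-Reasoning

  -- `A` is the set of cells still free. Taking for `T` all cells of a set of keys gives the usual
  -- form of Hall's condition.
  HallCondition : List K → Subset s → Set
  HallCondition ks A = ∀ T → confined ks T ≤ ∣ T ∩ A ∣

  Tight : List K → Subset s → Subset s → Set
  Tight ks A T = ∣ T ∩ A ∣ ≤ confined ks T

  -- Uncrossing: the number of free cells is modular and `confined` is supermodular, so the slack in
  -- Hall's condition is submodular. It vanishes at `T` and `T′` and is nonnegative at `T ∩ T′`,
  -- hence vanishes at `T ∪ T′`.
  Tight-∪ : ∀ ks A → HallCondition ks A → ∀ T T′ → Tight ks A T → Tight ks A T′ → Tight ks A (T ∪ T′)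
  Tight-∪ ks A hall T T′ tight tight′ = +-cancelʳ-≤ ∣ (T ∩ T′) ∩ A ∣ _ _ (begin
    ∣ (T ∪ T′) ∩ A ∣ + ∣ (T ∩ T′) ∩ A ∣
      ≡⟨ cong₂ (λ p q → ∣ p ∣ + ∣ q ∣) (S.∩-distribʳ-∪ A T T′) (∩-distribʳ-∩) ⟩
    ∣ (T ∩ A) ∪ (T′ ∩ A) ∣ + ∣ (T ∩ A) ∩ (T′ ∩ A) ∣
      ≡⟨ ∣p∪q∣+∣p∩q∣ (T ∩ A) (T′ ∩ A) ⟩
    ∣ T ∩ A ∣ + ∣ T′ ∩ A ∣
      ≤⟨ +-mono-≤ tight tight′ ⟩
    confined ks T + confined ks T′
      ≤⟨ confined-supermodular ks T T′ ⟩
    confined ks (T ∪ T′) + confined ks (T ∩ T′)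
      ≤⟨ +-monoʳ-≤ (confined ks (T ∪ T′)) (hall (T ∩ T′)) ⟩
    confined ks (T ∪ T′) + ∣ (T ∩ T′) ∩ A ∣ ∎)
    where
    open ≤-Reasoning
    ∩-distribʳ-∩ : (T ∩ T′) ∩ A ≡ (T ∩ A) ∩ (T′ ∩ A)
    ∩-distribʳ-∩ = S.⊆-antisym
      (λ x∈ → let x∈TT′ , x∈A = S.x∈p∩q⁻ (T ∩ T′) A x∈ ; x∈T , x∈T′ = S.x∈p∩q⁻ T T′ x∈TT′
              in S.x∈p∩q⁺ (S.x∈p∩q⁺ (x∈T , x∈A) , S.x∈p∩q⁺ (x∈T′ , x∈A)))
      (λ x∈ → let x∈TA , x∈T′A = S.x∈p∩q⁻ (T ∩ A) (T′ ∩ A) x∈ ; x∈T , x∈A = S.x∈p∩q⁻ T A x∈TA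
              in S.x∈p∩q⁺ (S.x∈p∩q⁺ (x∈T , proj₁ (S.x∈p∩q⁻ T′ A x∈T′A)) , x∈A))

  usable-or-tight : ∀ ks A → HallCondition ks A → ∀ y →
    (y ∈ˢ A × HallCondition ks (A - y)) ⊎ (∃ λ T → y ∈ˢ T × Tight ks A T)
  usable-or-tight ks A hall y with y S.∈? A
  -- A cell that is not free forms a tight singleton, since it contains no free cell.
  ... | no y∉A = inj₂ (⁅ y ⁆ , S.x∈⁅x⁆ y , ≤-trans (≤-reflexive (trans (cong ∣_∣ empty) (S.∣⊥∣≡0 s))) z≤n)
    where
    empty : ⁅ y ⁆ ∩ A ≡ ⊥
    empty = S.Empty-unique (λ (x , x∈) → let x∈⁅y⁆ , x∈A = S.x∈p∩q⁻ ⁅ y ⁆ A x∈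
      in y∉A (subst (_∈ˢ A) (S.x∈⁅y⁆⇒x≡y y x∈⁅y⁆) x∈A))
  ... | yes y∈A with S.anySubset? (λ T → ∣ T ∩ (A - y) ∣ <? confined ks T)
  ...   | no none = inj₁ (y∈A , λ T → ≮⇒≥ (λ T-bad → none (T , T-bad)))
  ...   | yes (T , T-bad) with y S.∈? T
  -- `T` violates Hall's condition once `y` is gone, and `y` is only one of its cells, so `T` was
  -- tight before.
  ...     | yes y∈T = inj₂ (T , y∈T , (begin
    ∣ T ∩ A ∣                    ≤⟨ S.p⊆q⇒∣p∣≤∣q∣ split ⟩
    ∣ ⁅ y ⁆ ∪ (T ∩ (A - y)) ∣    ≤⟨ m≤m+n _ _ ⟩
    ∣ ⁅ y ⁆ ∪ (T ∩ (A - y)) ∣ + ∣ ⁅ y ⁆ ∩ (T ∩ (A - y)) ∣  ≡⟨ ∣p∪q∣+∣p∩q∣ ⁅ y ⁆ (T ∩ (A - y)) ⟩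
    ∣ ⁅ y ⁆ ∣ + ∣ T ∩ (A - y) ∣  ≡⟨ cong (_+ ∣ T ∩ (A - y) ∣) (S.∣⁅x⁆∣≡1 y) ⟩
    suc ∣ T ∩ (A - y) ∣          ≤⟨ T-bad ⟩
    confined ks T                ∎))
    where
    open ≤-Reasoning
    split : T ∩ A ⊆ ⁅ y ⁆ ∪ (T ∩ (A - y))
    split {x} x∈ with x ≟ y | S.x∈p∩q⁻ T A x∈
    ... | yes refl | _         = S.x∈p∪q⁺ (inj₁ (S.x∈⁅x⁆ y))
    ... | no  x≢y  | x∈T , x∈A = S.x∈p∪q⁺ {p = ⁅ y ⁆} (inj₂ (S.x∈p∩q⁺ (x∈T , S.x∈p∧x≢y⇒x∈p-y x∈A x≢y)))
  ...     | no y∉T = contradiction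
    (≤-trans (hall T) (S.p⊆q⇒∣p∣≤∣q∣ same)) (<⇒≱ T-bad)
    where
    same : T ∩ A ⊆ T ∩ (A - y)
    same x∈ with x∈T , x∈A ← S.x∈p∩q⁻ T A x∈ =
      S.x∈p∩q⁺ (x∈T , S.x∈p∧x≢y⇒x∈p-y x∈A (λ { refl → y∉T x∈T }))

  usable-or-tight* : ∀ ks A → HallCondition ks A → ∀ {r} (ys : Vec (Fin s) r) →
    (∃ λ y → y ∈ ys × y ∈ˢ A × HallCondition ks (A - y)) ⊎ (∃ λ T → (∀ {y} → y ∈ ys → y ∈ˢ T) × Tight ks A T)
  usable-or-tight* ks A hall [] =
    inj₂ (⊥ , (λ ()) , ≤-trans (≤-reflexive (trans (cong ∣_∣ (S.∩-zeroˡ A)) (S.∣⊥∣≡0 s))) z≤n)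
  usable-or-tight* ks A hall (y ∷ ys) with usable-or-tight ks A hall y | usable-or-tight* ks A hall ys
  ... | inj₁ (y∈A , hall′)     | _ = inj₁ (y , here refl , y∈A , hall′)
  ... | inj₂ _                 | inj₁ (z , z∈ys , usable) = inj₁ (z , there z∈ys , usable)
  ... | inj₂ (T , y∈T , tight) | inj₂ (T′ , ys⊆T′ , tight′) =
    inj₂ (T ∪ T′ , (λ { (here refl) → S.x∈p∪q⁺ (inj₁ y∈T) ; (there z∈) → S.x∈p∪q⁺ {p = T} (inj₂ (ys⊆T′ z∈)) })
         , Tight-∪ ks A hall T T′ tight tight′)

  Assigned : (Fin s → Maybe K) → K → Set
  Assigned g k = ∃ λ y → y ∈ N k × g y ≡ just k

  -- The clause that `g` is empty outside `A` protects earlier choices: the recursive call works in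
  -- `A - y`, so giving `y` to the first key displaces no other key.
  matching : ∀ ks A → HallCondition ks A →
    ∃ λ (g : Fin s → Maybe K) → (∀ y → y ∉ˢ A → g y ≡ nothing) × All (Assigned g) ks
  matching []       A hall = (λ _ → nothing) , (λ _ _ → refl) , []
  matching (k ∷ ks) A hall with usable-or-tight* ks A hall-ks (N k)
    where
    hall-ks : HallCondition ks A
    hall-ks T = ≤-trans (m≤n+m _ (𝟙 (covers T (N k)))) (hall T)
  -- The set `T` is already filled by the keys `ks` and also confines `k`, one key too many.
  ... | inj₂ (T , Nk⊆T , tight) = contradiction (≤-trans (hall T) tight) (<⇒≱ grows)
    where
    grows : confined ks T < confined (k ∷ ks) T
    grows rewrite ∈⇒covers {T = T} {is = N k} Nk⊆T = ≤-refl
  ... | inj₁ (y , y∈Nk , y∈A , hall′) with matching ks (A - y) hall′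
  ...   | g′ , g′-outside , assigned = g , g-outside , (y , y∈Nk , g-y) ∷ All.map keep assigned
    where
    g : Fin s → Maybe K
    g z with z ≟ y
    ... | yes _ = just k
    ... | no  _ = g′ z

    g-y : g y ≡ just k
    g-y with y ≟ y
    ... | yes _   = refl
    ... | no  y≢y = contradiction refl y≢y

    g-outside : ∀ z → z ∉ˢ A → g z ≡ nothing
    g-outside z z∉A with z ≟ y
    ... | yes refl = contradiction y∈A z∉A
    ... | no  _    = g′-outside z (z∉A ∘ S.p─q⊆p A ⁅ y ⁆)

    keep : ∀ {k′} → Assigned g′ k′ → Assigned g k′
    keep {k′} (z , z∈Nk′ , g′z≡k′) = z , z∈Nk′ , gz≡k′
      where
      gz≡k′ : g z ≡ just k′
      gz≡k′ with z ≟ y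
      ... | no _ = g′z≡k′
      ... | yes refl with () ← trans (sym g′z≡k′) (g′-outside y (x∉p-x A y))

-- Existence of the bipartite graph

-- The constant 32 is 2 * 4 * 4: the 2 makes the terms for successive sizes `j` geometric, and each
-- 4 pays for replacing a power by a factorial. Multiplying by `E` clears all denominators.
union-bound-term : ∀ n u s r j .⦃ _ : NonZero s ⦄ → 32 * u * n ^ r ≤ s ^ suc r → j ≤ n → j ≤ s →
  tail 1 1 s j * tail (s ^ (2 + r)) (j ^ (2 + r)) u (suc j) * 2 ^ suc j ≤ (s ^ (2 + r)) ^ u
union-bound-term n u s r j 32un^r≤s^[1+r] j≤n j≤s =
  *-cancelʳ-≤ _ _ E ⦃ E≢0 ⦄ (begin
    b * g * 2 ^ suc j * E
      ≡⟨ regroup b g (2 ^ suc j) (j !) (suc j !) (N ^ suc j) (4 ^ j) (4 ^ suc j) ⟩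
    b * (j !) * (g * (suc j ! * N ^ suc j)) * (2 ^ suc j * 4 ^ j * 4 ^ suc j)
      ≤⟨ *-mono-≤ (*-mono-≤ b-bound (tail-bound N (j ^ t) u (suc j))) powers ⟩
    s ^ j * ((u * j ^ t) ^ suc j * N ^ u) * 32 ^ suc j
      ≡⟨ regroup₂ (s ^ j) ((u * j ^ t) ^ suc j) (N ^ u) (32 ^ suc j) ⟩
    s ^ j * (32 ^ suc j * (u * j ^ t) ^ suc j) * N ^ u
      ≡⟨ cong (λ k → s ^ j * k * N ^ u) (^-distribʳ 32 (u * j ^ t) (suc j)) ⟨
    s ^ j * (32 * (u * j ^ t)) ^ suc j * N ^ u
      ≤⟨ *-monoˡ-≤ (N ^ u) (*-monoʳ-≤ (s ^ j) (^-monoˡ-≤ (suc j) 32uj^t≤)) ⟩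
    s ^ j * (s ^ suc r * (j * j)) ^ suc j * N ^ u
      ≡⟨ cong (λ k → s ^ j * k * N ^ u) (trans (^-distribʳ (s ^ suc r) (j * j) (suc j)) (cong ((s ^ suc r) ^ suc j *_) (^-distribʳ j j (suc j)))) ⟩
    s ^ j * ((s ^ suc r) ^ suc j * (j ^ suc j * j ^ suc j)) * N ^ u
      ≡⟨ regroup₃ (s ^ j) ((s ^ suc r) ^ suc j) j (j ^ j) (N ^ u) ⟩
    j * s ^ j * (s ^ suc r) ^ suc j * (j ^ j * (j * j ^ j)) * N ^ u
      -- One spare factor `j` is raised to `s`, which completes `N ^ suc j`; the other powers of `j`
      -- turn into the factorials in `E`.
      ≤⟨ *-monoˡ-≤ (N ^ u) (*-mono-≤ (*-monoˡ-≤ ((s ^ suc r) ^ suc j) (*-monoˡ-≤ (s ^ j) j≤s))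
           (*-mono-≤ (n^n≤4^n*n! j) (≤-trans (^-monoˡ-≤ (suc j) (n≤1+n j)) (n^n≤4^n*n! (suc j))))) ⟩
    s ^ suc j * (s ^ suc r) ^ suc j * (4 ^ j * j ! * (4 ^ suc j * suc j !)) * N ^ u
      ≡⟨ cong (λ k → k * (4 ^ j * j ! * (4 ^ suc j * suc j !)) * N ^ u) (^-distribʳ s (s ^ suc r) (suc j)) ⟨
    N ^ suc j * (4 ^ j * j ! * (4 ^ suc j * suc j !)) * N ^ u
      ≡⟨ regroup₄ (N ^ suc j) (4 ^ j) (j !) (4 ^ suc j) (suc j !) (N ^ u) ⟩
    N ^ u * E ∎)
  where
  open ≤-Reasoning
  t = 2 + r
  N = s ^ t
  b = tail 1 1 s j
  g = tail N (j ^ t) u (suc j)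
  E = j ! * suc j ! * N ^ suc j * (4 ^ j * 4 ^ suc j)

  E≢0 : NonZero E
  E≢0 = m*n≢0 _ _ ⦃ m*n≢0 _ _ ⦃ m*n≢0 _ _ ⦃ j !≢0 ⦄ ⦃ suc j !≢0 ⦄ ⦄ ⦃ m^n≢0 N (suc j) ⦃ m^n≢0 s t ⦄ ⦄ ⦄
                  ⦃ m*n≢0 _ _ ⦃ m^n≢0 4 j ⦄ ⦃ m^n≢0 4 (suc j) ⦄ ⦄

  b-bound : b * j ! ≤ s ^ j
  b-bound = begin
    b * j !               ≡⟨ cong (b *_) (trans (cong (j ! *_) (^-zeroˡ j)) (*-identityʳ (j !))) ⟨
    b * (j ! * 1 ^ j)     ≤⟨ tail-bound 1 1 s j ⟩
    (s * 1) ^ j * 1 ^ s   ≡⟨ cong₂ (λ k l → k ^ j * l) (*-identityʳ s) (^-zeroˡ s) ⟩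
    s ^ j * 1             ≡⟨ *-identityʳ (s ^ j) ⟩
    s ^ j                 ∎

  powers : 2 ^ suc j * 4 ^ j * 4 ^ suc j ≤ 32 ^ suc j
  powers = begin
    2 ^ suc j * 4 ^ j * 4 ^ suc j      ≤⟨ *-monoˡ-≤ (4 ^ suc j) (*-monoʳ-≤ (2 ^ suc j) (^-monoʳ-≤ 4 (n≤1+n j))) ⟩
    2 ^ suc j * 4 ^ suc j * 4 ^ suc j  ≡⟨ cong (_* 4 ^ suc j) (^-distribʳ 2 4 (suc j)) ⟨
    8 ^ suc j * 4 ^ suc j              ≡⟨ ^-distribʳ 8 4 (suc j) ⟨
    32 ^ suc j                         ∎

  -- Two of the `t` factors `j` are set aside to cancel the factorials; the other `r` are raised to
  -- `n` to meet the hypothesis.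
  32uj^t≤ : 32 * (u * j ^ t) ≤ s ^ suc r * (j * j)
  32uj^t≤ = begin
    32 * (u * (j * (j * j ^ r)))  ≡⟨ regroup₅ u j (j ^ r) ⟩
    32 * u * j ^ r * (j * j)      ≤⟨ *-monoˡ-≤ (j * j) (*-monoʳ-≤ (32 * u) (^-monoˡ-≤ r j≤n)) ⟩
    32 * u * n ^ r * (j * j)      ≤⟨ *-monoˡ-≤ (j * j) 32un^r≤s^[1+r] ⟩
    s ^ suc r * (j * j)           ∎
    where
    regroup₅ : ∀ u j p → 32 * (u * (j * (j * p))) ≡ 32 * u * p * (j * j)
    regroup₅ = solve-∀

  regroup : ∀ b g p f f′ M q q′ → b * g * p * (f * f′ * M * (q * q′)) ≡ b * f * (g * (f′ * M)) * (p * q * q′)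
  regroup = solve-∀
  regroup₂ : ∀ x y z w → x * (y * z) * w ≡ x * (w * y) * z
  regroup₂ = solve-∀
  regroup₃ : ∀ x y j p z → x * (y * (j * p * (j * p))) * z ≡ j * x * y * (p * (j * p)) * z
  regroup₃ = solve-∀
  regroup₄ : ∀ M q f q′ f′ z → M * (q * f * (q′ * f′)) * z ≡ z * (f * f′ * M * (q * q′))
  regroup₄ = solve-∀

length-allFin : ∀ n → length (allFin n) ≡ n
length-allFin n = List.length-tabulate {n = n} (λ i → i)

expander : ∀ n u s r .⦃ _ : NonZero s ⦄ → 32 * u * n ^ r ≤ s ^ suc r → n ≤ s →
  ∃ λ (f : Fin u → Vec (Fin s) (2 + r)) →
    ∀ T → ∣ T ∣ < n → ∑ (allFin u) (λ x → 𝟙 (covers T (f x))) ≤ ∣ T ∣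
expander n u s r cond n≤s = proj₁ found , λ T ∣T∣<n →
  s≤s⁻¹ (All.lookup (proj₂ found) (∈-subsets< T n ∣T∣<n))
  where
  t = 2 + r
  vs = vecs (allFin s) t

  length-vs : length vs ≡ s ^ t
  length-vs = trans (length-vecs (allFin s) t) (cong (_^ t) (length-allFin s))

  potential : Subset s → ℕ
  potential T = tail (length vs) (∣ T ∣ ^ t) u (suc ∣ T ∣)

  each : ∀ j → j < n → ∑ (subsets s j) potential * 2 ^ suc j ≤ length vs ^ u
  each j j<n = begin
    ∑ (subsets s j) potential * 2 ^ suc j
      ≡⟨ cong (_* 2 ^ suc j) (∑-const (All.map (cong (λ k → tail (length vs) (k ^ t) u (suc k))) (subsets-size s j))) ⟩
    length (subsets s j) * tail (length vs) (j ^ t) u (suc j) * 2 ^ suc j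
      ≡⟨ cong₂ (λ k N → k * tail N (j ^ t) u (suc j) * 2 ^ suc j) (length-subsets s j) length-vs ⟩
    tail 1 1 s j * tail (s ^ t) (j ^ t) u (suc j) * 2 ^ suc j
      ≤⟨ union-bound-term n u s r j cond (<⇒≤ j<n) (≤-trans (<⇒≤ j<n) n≤s) ⟩
    (s ^ t) ^ u
      ≡⟨ cong (_^ u) length-vs ⟨
    length vs ^ u ∎
    where open ≤-Reasoning

  small : ∑ (subsets< s n) potential < length vs ^ u
  small = *-cancelʳ-< (2 ^ n) _ _ (<-≤-trans (m<m+n _ 0<M) (∑-subsets< s n potential (length vs ^ u) each))
    where
    0<M : 0 < length vs ^ u
    0<M rewrite length-vs = m^n>0 (s ^ t) ⦃ m^n≢0 s t ⦄ u

  found = derandomise vs covers (λ T → ∣ T ∣ ^ t) (λ T → ≤-reflexive (∑-covers T t))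
            (subsets< s n) u (λ T → suc ∣ T ∣) small

-- Assigning cells to the keys of an input

∑-filter : ∀ {A : Set} {P : A → Set} (P? : Decidable P) xs f → ∑ (filter P? xs) f ≤ ∑ xs f
∑-filter P? []       f = z≤n
∑-filter P? (x ∷ xs) f with P? x
... | yes _ = +-monoʳ-≤ (f x) (∑-filter P? xs f)
... | no  _ = ≤-trans (∑-filter P? xs f) (m≤n+m _ (f x))

length-filter : ∀ {A : Set} {P : A → Set} (P? : Decidable P) xs → length (filter P? xs) ≡ ∑ xs (𝟙 ∘ does ∘ P?)
length-filter P? []       = refl
length-filter P? (x ∷ xs) with P? x
... | yes _ = cong suc (length-filter P? xs)
... | no  _ = length-filter P? xs

-- As `g` maps cells to keys, no cell can serve two keys.
Assignable : ∀ {u s t} → ℕ → (Fin u → Vec (Fin s) t) → Set₁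
Assignable {u} {s} n f = ∀ {P : Fin u → Set} (P? : Decidable P) → length (filter P? (allFin u)) ≤ n →
  ∃ λ (g : Fin s → Maybe (Fin u)) → ∀ x → P x → ∃ λ y → y ∈ f x × g y ≡ just x

-- Sets of at least `n` cells meet Hall's condition because at most `n` keys are present; expansion
-- handles the smaller ones.
expander⇒Assignable : ∀ {n u s t} (f : Fin u → Vec (Fin s) t) →
  (∀ T → ∣ T ∣ < n → ∑ (allFin u) (λ x → 𝟙 (covers T (f x))) ≤ ∣ T ∣) → Assignable n f
expander⇒Assignable {n} {u} {s} f expands {P} P? few =
  let g , _ , assigned = matching keys ⊤ hall
  in g , λ x Px → All.lookup assigned (∈-filter⁺ P? (∈-allFin x) Px)
  where
  open Hall f
  keys = filter P? (allFin u)

  confined≤ : ∀ T → confined keys T ≤ ∣ T ∣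
  confined≤ T with ∣ T ∣ <? n
  ... | yes ∣T∣<n = ≤-trans (∑-filter P? (allFin u) _) (expands T ∣T∣<n)
  ... | no  ∣T∣≮n = begin
    confined keys T      ≤⟨ ∑-mono keys (λ x → 𝟙≤1 (covers T (f x))) ⟩
    ∑ keys (λ _ → 1)     ≡⟨ length≡∑1 keys ⟨
    length keys          ≤⟨ few ⟩
    n                    ≤⟨ ≮⇒≥ ∣T∣≮n ⟩
    ∣ T ∣                ∎
    where
    open ≤-Reasoning
    𝟙≤1 : ∀ b → 𝟙 b ≤ 1
    𝟙≤1 true  = ≤-refl
    𝟙≤1 false = z≤n

  hall : HallCondition keys ⊤
  hall T = subst (λ T′ → confined keys T ≤ ∣ T′ ∣) (sym (S.∩-identityʳ T)) (confined≤ T)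

direct-Assignable : ∀ {u s} n (u≤s : u ≤ s) → Assignable n (λ (x : Fin u) → inject≤ x u≤s ∷ [])
direct-Assignable {u} {s} n u≤s P? _ = g , λ x _ → inject≤ x u≤s , here refl , g-inject x
  where
  g : Fin s → Maybe (Fin u)
  g y with toℕ y <? u
  ... | yes y<u = just (fromℕ< y<u)
  ... | no  _   = nothing

  g-inject : ∀ x → g (inject≤ x u≤s) ≡ just x
  g-inject x with toℕ (inject≤ x u≤s) <? u
  ... | yes y<u = cong just (trans (fromℕ<-cong _ _ (toℕ-inject≤ x u≤s) y<u (toℕ<n x)) (fromℕ<-toℕ x (toℕ<n x)))
  ... | no  y≮u = contradiction (subst (_< u) (sym (toℕ-inject≤ x u≤s)) (toℕ<n x)) y≮u

∣p++q∣ : ∀ {m n} (p : Subset m) (q : Subset n) → ∣ p Vec.++ q ∣ ≡ ∣ p ∣ + ∣ q ∣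
∣p++q∣ []            q = refl
∣p++q∣ (inside  ∷ p) q = cong suc (∣p++q∣ p q)
∣p++q∣ (outside ∷ p) q = ∣p++q∣ p q

x∈p⇒0<∣p∣ : ∀ {n} {x : Fin n} {p : Subset n} → x ∈ˢ p → 0 < ∣ p ∣
x∈p⇒0<∣p∣ {x = x} {p} x∈p = subst (_≤ ∣ p ∣) (S.∣⁅x⁆∣≡1 x)
  (S.p⊆q⇒∣p∣≤∣q∣ (λ y∈ → subst (_∈ˢ p) (sym (S.x∈⁅y⁆⇒x≡y x y∈)) x∈p))

-- Under `combine`, the vector `p` is a concatenation of `m` rows, one per key, and each marked row
-- contributes at least one element.
∑-rows≤∣p∣ : ∀ m {k} (p : Subset (m * k)) (b : Fin m → Bool) →
  (∀ x → b x ≡ true → ∃ λ y → combine x y ∈ˢ p) → ∑ (allFin m) (𝟙 ∘ b) ≤ ∣ p ∣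
∑-rows≤∣p∣ zero        p b _        = z≤n
∑-rows≤∣p∣ (suc m) {k} p b nonempty with Vec.splitAt k p
... | row , rest , refl = begin
  ∑ (allFin (suc m)) (𝟙 ∘ b)              ≡⟨ ∑-allFin-suc m (𝟙 ∘ b) ⟩
  𝟙 (b zero) + ∑ (allFin m) (𝟙 ∘ b ∘ suc) ≤⟨ +-mono-≤ first (∑-rows≤∣p∣ m rest (b ∘ suc) others) ⟩
  ∣ row ∣ + ∣ rest ∣                       ≡⟨ ∣p++q∣ row rest ⟨
  ∣ row Vec.++ rest ∣                          ∎
  where
  open ≤-Reasoning
  first : 𝟙 (b zero) ≤ ∣ row ∣
  first with b zero in b0
  ... | false = z≤n
  ... | true  = let y , y∈ = nonempty zero b0 in
    x∈p⇒0<∣p∣ (lookup⇒[]= y row (trans (sym (lookup-++ˡ row rest y)) ([]=⇒lookup y∈)))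

  others : ∀ x → b (suc x) ≡ true → ∃ λ y → combine x y ∈ˢ rest
  others x bx = let y , y∈ = nonempty (suc x) bx in
    y , lookup⇒[]= _ rest (trans (sym (lookup-++ʳ row rest (combine x y))) ([]=⇒lookup y∈))

-- The dictionary

bits : ∀ w → Fin (2 ^ w) → Vec Bool w
bits zero    _ = []
bits (suc w) k = Inverse.to 2↔Bool (quotient (2 ^ w) k) ∷ bits w (remainder {2} (2 ^ w) k)

bits-injective : ∀ w {k l} → bits w k ≡ bits w l → k ≡ l
bits-injective zero    {zero} {zero} _  = refl
bits-injective (suc w) {k}    {l}    eq with Vec.∷-injective eq
... | q-eq , r-eq = begin
  k ≡⟨ combine-remQuot {2} (2 ^ w) k ⟨
  combine (quotient (2 ^ w) k) (remainder {2} (2 ^ w) k)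
    ≡⟨ cong₂ combine (Injection.injective (↔⇒↣ 2↔Bool) q-eq) (bits-injective w r-eq) ⟩
  combine (quotient (2 ^ w) l) (remainder {2} (2 ^ w) l)
    ≡⟨ combine-remQuot {2} (2 ^ w) l ⟩
  l ∎
  where open ≡-Reasoning

Cell : ℕ → Set
Cell u = Maybe (Fin u × Fin u)

-- Zero is reserved for the empty cell, so `u * u + 1` codes have to fit into `w` bits; this is what
-- `u*u<2^w` says.
code : ∀ {u} → Cell u → Fin (suc (u * u))
code nothing        = zero
code (just (x , y)) = suc (combine x y)

code-injective : ∀ {u} {c d : Cell u} → code c ≡ code d → c ≡ d
code-injective {c = nothing} {nothing} _ = refl
code-injective {c = just (x , y)} {just (x′ , y′)} eq with combine-injective x y x′ y′ (sucFin-injective eq)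
... | refl , refl = refl

module _ {n u s w t : ℕ} (u*u<2^w : u * u < 2 ^ w)
         (probe : Fin u → Vec (Fin s) t) (assignable : Assignable n probe) where

  private
    encode : Cell u → Vec Bool w
    encode c = bits w (inject≤ (code c) u*u<2^w)

    encode-injective : ∀ {c d} → encode c ≡ encode d → c ≡ d
    encode-injective = code-injective ∘ inject≤-injective _ _ _ _ ∘ bits-injective w

    -- Cells are compared with the encodings of all candidate pairs, so injectivity of `encode`
    -- takes the place of a decoder.
    find : ∀ {r} → Fin u → Vec (Vec Bool w) r → Maybe (Fin u)
    find x []       = nothing
    find x (m ∷ ms) with any? (λ y → Vec.≡-dec Bool._≟_ m (encode (just (x , y))))
    ... | yes (y , _) = just y
    ... | no  _       = find x ms

    module _ (X : Input n u) where

      HasValue : Fin u → Set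
      HasValue x = ∃ λ y → combine x y ∈ˢ pairs X

      hasValue? : ∀ x → Dec (HasValue x)
      hasValue? x = any? (λ y → combine x y S.∈? pairs X)

      few : length (filter hasValue? (allFin u)) ≤ n
      few = subst₂ _≤_ (sym (length-filter hasValue? (allFin u))) (size X)
        (∑-rows≤∣p∣ u (pairs X) (does ∘ hasValue?) value)
        where
        value : ∀ x → does (hasValue? x) ≡ true → HasValue x
        value x eq with yes v ← hasValue? x = v

      assignment = assignable hasValue? few

      -- The assignment may name keys absent from the input, as the direct one does; their cells
      -- stay empty.
      withValue : Maybe (Fin u) → Cell u
      withValue nothing  = nothing
      withValue (just x) with hasValue? x
      ... | yes (y , _) = just (x , y)
      ... | no  _       = nothing

      withValue-sound : ∀ k {x y} → withValue k ≡ just (x , y) → combine x y ∈ˢ pairs X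
      withValue-sound (just x) eq with hasValue? x
      withValue-sound (just x) refl | yes (y , xy∈X) = xy∈X

      withValue-complete : ∀ {x y} → combine x y ∈ˢ pairs X → withValue (just x) ≡ just (x , y)
      withValue-complete {x} {y} xy∈X with hasValue? x
      ... | yes (y′ , xy′∈X) = cong (λ z → just (x , z)) (functional X x y′ y xy′∈X xy∈X)
      ... | no  none         = contradiction (y , xy∈X) none

      content : Fin s → Cell u
      content = withValue ∘ proj₁ assignment

      content-complete : ∀ {x y} → combine x y ∈ˢ pairs X → ∃ λ i → i ∈ probe x × content i ≡ just (x , y)
      content-complete {x} {y} xy∈X with i , i∈ , g-i ← proj₂ assignment x (y , xy∈X) =
        i , i∈ , trans (cong withValue g-i) (withValue-complete xy∈X)

      memory : Memory s w
      memory = tabulate (encode ∘ content)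

      -- The invariant is that a value of `x`, if any, sits in the remaining cells. A match is sound
      -- because cells hold only pairs of `X`; a mismatch rules out the current cell.
      find-correct : ∀ {r} x (is : Vec (Fin s) r) →
        (∀ y → combine x y ∈ˢ pairs X → ∃ λ i → i ∈ is × content i ≡ just (x , y)) →
        IsAnswer X x (find x (Vec.map (lookup memory) is))
      find-correct x []       stored y xy∈X with () ← proj₁ (proj₂ (stored y xy∈X))
      find-correct x (i ∷ is) stored
        with any? (λ y → Vec.≡-dec Bool._≟_ (lookup memory i) (encode (just (x , y))))
      ... | yes (y , eq) = withValue-sound (proj₁ assignment i) (encode-injective (trans (sym (lookup∘tabulate _ i)) eq))
      ... | no  absent   = find-correct x is stored-in-rest
        where
        stored-in-rest : ∀ y → combine x y ∈ˢ pairs X → ∃ λ j → j ∈ is × content j ≡ just (x , y)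
        stored-in-rest y xy∈X with stored y xy∈X
        ... | j , there j∈ , eq = j , j∈ , eq
        ... | _ , here refl , eq = contradiction (y , trans (lookup∘tabulate _ i) (cong encode eq)) absent

  dictionary : NonAdaptiveDictionary n u s w t
  dictionary = record
    { store   = memory
    ; probes  = probe
    ; answer  = find
    ; correct = λ X x → find-correct X x (probe x) (λ _ → content-complete X)
    }

-- Logarithms

pos-*-≤ : ∀ a b c d → a * d ≤ c * b → pos a ℤ.* pos d ℤ.≤ pos c ℤ.* pos b
pos-*-≤ a b c d ad≤cb = subst₂ ℤ._≤_ (ℤ.pos-* a d) (ℤ.pos-* c b) (ℤ.+≤+ ad≤cb)

^-cancelʳ-≤ : ∀ k m n → 1 < k → k ^ m ≤ k ^ n → m ≤ n
^-cancelʳ-≤ k m n 1<k k^m≤k^n = ≮⇒≥ (λ n<m → <⇒≱ (^-monoʳ-< k 1<k n<m) k^m≤k^n)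

-- A nonnegative `a / b` in the cut gives `2 ^ a ≤ u ^ b ≤ 2 ^ (W * b)`, and exponents can be
-- compared.
lg≼fromℕ : ∀ {u w} W → u ≤ 2 ^ W → W ≤ w → lg[ u / 1 ] ≼ fromℕ w
lg≼fromℕ {u} {w} W u≤2^W W≤w (mkℚᵘ (pos a) d) 2^a≤u^b = ℚᵘ.*≤* (pos-*-≤ a (suc d) w 1 (begin
  a * 1        ≡⟨ *-identityʳ a ⟩
  a            ≤⟨ ^-cancelʳ-≤ 2 a (W * suc d) (s≤s (s≤s z≤n)) 2^a≤2^Wb ⟩
  W * suc d    ≤⟨ *-monoˡ-≤ (suc d) W≤w ⟩
  w * suc d    ∎))
  where
  open ≤-Reasoning
  2^a≤2^Wb : 2 ^ a ≤ 2 ^ (W * suc d)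
  2^a≤2^Wb = begin
    2 ^ a              ≡⟨ trans (cong (2 ^ a *_) (^-zeroˡ (suc d))) (*-identityʳ (2 ^ a)) ⟨
    2 ^ a * 1 ^ suc d  ≤⟨ 2^a≤u^b ⟩
    u ^ suc d          ≤⟨ ^-monoˡ-≤ (suc d) u≤2^W ⟩
    (2 ^ W) ^ suc d    ≡⟨ ^-*-assoc 2 W (suc d) ⟩
    2 ^ (W * suc d)    ∎
lg≼fromℕ {w = w} W _ _ (mkℚᵘ -[1+ a ] d) _ = ℚᵘ.*≤* (subst (-[1+ a ] ℤ.* pos 1 ℤ.≤_) (ℤ.pos-* w (suc d)) ℤ.-≤+)

fromℕ≼·lg : ∀ {u w c} L → 2 ^ L ≤ u → w ≤ c * L → fromℕ w ≼ c · lg[ u / 1 ]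
fromℕ≼·lg {u} {w} {c} L 2^L≤u w≤cL r r≤w = mkℚᵘ (pos L) 0 , lg-L , ℚᵘ.≤-trans r≤w (ℚᵘ.*≤* w≤)
  where
  lg-L : 2 ^ L * 1 ≤ u * 1
  lg-L = *-monoˡ-≤ 1 2^L≤u
  w≤ : pos w ℤ.* pos 1 ℤ.≤ (pos c ℤ.* pos L) ℤ.* pos 1
  w≤ = ℤ.*-monoʳ-≤-nonNeg (pos 1) (subst (pos w ℤ.≤_) (ℤ.pos-* c L) (ℤ.+≤+ w≤cL))

-- The hypothesis is `(s / n) ^ t ≤ (u / n) ^ c` without division, so `t / c` lies in the cut of the
-- quotient: for `a / b` below lg (s / n), the number `(t * a) / (c * b)` is below lg (u / n).
fromℕ≼·lg÷lg : ∀ {n u s t} c .⦃ _ : NonZero n ⦄ .⦃ _ : NonZero c ⦄ → s ^ t * n ^ c ≤ u ^ c * n ^ t →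
  fromℕ t ≼ c · (lg[ u / n ] ÷ lg[ s / n ])
fromℕ≼·lg÷lg {n} {u} {s} {t} c@(suc c-1) H r r≤t = mkℚᵘ (pos t) c-1 , below , ℚᵘ.≤-trans r≤t (ℚᵘ.*≤* t≤)
  where
  t≤ : pos t ℤ.* pos (1 * c) ℤ.≤ (pos c ℤ.* pos t) ℤ.* pos 1
  t≤ = subst (λ z → pos t ℤ.* pos (1 * c) ℤ.≤ z ℤ.* pos 1) (ℤ.pos-* c t)
         (pos-*-≤ t 1 (c * t) (1 * c) (≤-reflexive (lem t c)))
    where
    lem : ∀ t c → t * (1 * c) ≡ c * t * 1
    lem = solve-∀

  powers : ∀ a b → 2 ^ a * n ^ b ≤ s ^ b → 2 ^ (t * a) * n ^ (c * b) ≤ u ^ (c * b)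
  powers a b h = *-cancelʳ-≤ _ _ (n ^ (t * b)) ⦃ m^n≢0 n (t * b) ⦄ (begin
    2 ^ (t * a) * n ^ (c * b) * n ^ (t * b)
      ≡⟨ cong₂ (λ i j → 2 ^ i * n ^ (c * b) * n ^ j) (*-comm t a) (*-comm t b) ⟩
    2 ^ (a * t) * n ^ (c * b) * n ^ (b * t)
      ≡⟨ cong₂ (λ p q → p * n ^ (c * b) * q) (^-*-assoc 2 a t) (^-*-assoc n b t) ⟨
    (2 ^ a) ^ t * n ^ (c * b) * (n ^ b) ^ t
      ≡⟨ swap ((2 ^ a) ^ t) (n ^ (c * b)) ((n ^ b) ^ t) ⟩
    (2 ^ a) ^ t * (n ^ b) ^ t * n ^ (c * b)
      ≡⟨ cong₂ _*_ (^-distribʳ (2 ^ a) (n ^ b) t) (^-*-assoc n c b) ⟨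
    (2 ^ a * n ^ b) ^ t * (n ^ c) ^ b
      ≤⟨ *-monoˡ-≤ ((n ^ c) ^ b) (^-monoˡ-≤ t h) ⟩
    (s ^ b) ^ t * (n ^ c) ^ b
      ≡⟨ cong (_* (n ^ c) ^ b) (trans (^-*-assoc s b t) (trans (cong (s ^_) (*-comm b t)) (sym (^-*-assoc s t b)))) ⟩
    (s ^ t) ^ b * (n ^ c) ^ b
      ≡⟨ ^-distribʳ (s ^ t) (n ^ c) b ⟨
    (s ^ t * n ^ c) ^ b
      ≤⟨ ^-monoˡ-≤ b H ⟩
    (u ^ c * n ^ t) ^ b
      ≡⟨ ^-distribʳ (u ^ c) (n ^ t) b ⟩
    (u ^ c) ^ b * (n ^ t) ^ b
      ≡⟨ cong₂ _*_ (^-*-assoc u c b) (^-*-assoc n t b) ⟩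
    u ^ (c * b) * n ^ (t * b) ∎)
    where
    open ≤-Reasoning
    swap : ∀ x y z → x * y * z ≡ x * z * y
    swap = solve-∀

  below : (lg[ u / n ] ÷ lg[ s / n ]) (mkℚᵘ (pos t) c-1)
  below (mkℚᵘ (pos a)    d) _         h = subst (λ z → lg[ u / n ] (z ℚᵘ./ (c * suc d))) (ℤ.pos-* t a) (powers a (suc d) h)
  below (mkℚᵘ -[1+ a ] d) (ℚᵘ.*≤* ()) h

-- Choice of parameters and assembly

least : ∀ {P : ℕ → Set} → Decidable P → ∀ m → P m → ∃ λ k → P k × (∀ {j} → k ≡ suc j → ¬ P j)
least P? zero    P0 = zero , P0 , λ ()
-- The search runs down from `m` and stops above the first failure, so minimality means only that
-- the predecessor fails.
least P? (suc m) Pm with P? m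
... | yes p  = least P? m p
... | no  ¬p = suc m , Pm , λ { refl → ¬p }

n<2^n : ∀ n → n < 2 ^ n
n<2^n zero    = z<s
n<2^n (suc n) = begin-strict
  suc n              ≤⟨ n<2^n n ⟩
  2 ^ n              <⟨ m<m+n (2 ^ n) (m^n>0 2 n) ⟩
  2 ^ n + 2 ^ n      ≡⟨ cong (λ k → 2 ^ n + k) (+-identityʳ (2 ^ n)) ⟨
  2 ^ suc n          ∎
  where open ≤-Reasoning

⌊lg⌋ : ∀ u → 1 ≤ u → ∃ λ L → 2 ^ L ≤ u × u < 2 ^ suc L
⌊lg⌋ u 1≤u with least (λ k → u <? 2 ^ suc k) u (<-trans (n<2^n u) (^-monoʳ-< 2 ≤-refl (n<1+n u)))
... | zero  , u<2 , _       = zero , 1≤u , u<2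
... | suc L , u<  , minimal = suc L , ≮⇒≥ (minimal refl) , u<

-- The second inequality is `(s / n) ^ (2 + r) ≤ (u / n) ^ 4`, the form consumed by `fromℕ≼·lg÷lg`.
probe-count : ∀ n u s → 1 ≤ n → 32 * n ≤ s → s ≤ u →
  ∃ λ r → 32 * u * n ^ r ≤ s ^ suc r × s ^ (2 + r) * n ^ 4 ≤ u ^ 4 * n ^ (2 + r)
probe-count n u s 1≤n 32n≤s s≤u = from-least (least (λ r → 32 * u * n ^ r ≤? s ^ suc r) u large)
  where
  open ≤-Reasoning
  n≤s : n ≤ s
  n≤s = ≤-trans (m≤n*m n 32) 32n≤s

  large : 32 * u * n ^ u ≤ s ^ suc u
  large = begin
    32 * u * n ^ u        ≤⟨ *-monoˡ-≤ (n ^ u) (*-monoʳ-≤ 32 (≤-trans (<⇒≤ (n<2^n u)) (^-monoˡ-≤ u (s≤s (s≤s z≤n))))) ⟩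
    32 * 32 ^ u * n ^ u   ≡⟨ *-assoc 32 (32 ^ u) (n ^ u) ⟩
    32 * (32 ^ u * n ^ u) ≡⟨ cong (32 *_) (^-distribʳ 32 n u) ⟨
    32 * (32 * n) ^ u     ≤⟨ *-mono-≤ (≤-trans (*-monoʳ-≤ 32 1≤n) 32n≤s) (^-monoˡ-≤ u 32n≤s) ⟩
    s * s ^ u             ∎

  Q : ℕ → Set
  Q r = 32 * u * n ^ r ≤ s ^ suc r × s ^ (2 + r) * n ^ 4 ≤ u ^ 4 * n ^ (2 + r)

  from-least : (∃ λ r → 32 * u * n ^ r ≤ s ^ suc r × (∀ {j} → r ≡ suc j → ¬ (32 * u * n ^ j ≤ s ^ suc j))) → ∃ Q
  from-least (zero , enough , _) = zero , enough , (begin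
    s ^ 2 * n ^ 4        ≡⟨ cong (s ^ 2 *_) (^-distribˡ-+-* n 2 2) ⟩
    s ^ 2 * (n ^ 2 * n ^ 2) ≡⟨ *-assoc (s ^ 2) (n ^ 2) (n ^ 2) ⟨
    s ^ 2 * n ^ 2 * n ^ 2 ≤⟨ *-monoˡ-≤ (n ^ 2) (*-mono-≤ (^-monoˡ-≤ 2 s≤u) (^-monoˡ-≤ 2 (≤-trans n≤s s≤u))) ⟩
    u ^ 2 * u ^ 2 * n ^ 2 ≡⟨ cong (_* n ^ 2) (^-distribˡ-+-* u 2 2) ⟨
    u ^ 4 * n ^ 2        ∎)
  -- Failure at `j` bounds `s ^ suc j` by `32 * u * n ^ j`. The two other factors `s`, the factor
  -- `u` and `32 * n` are each at most `u`, whence the exponent 4.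
  from-least (suc j , enough , minimal) = suc j , enough , (begin
    s * (s * s ^ suc j) * n ^ 4
      ≤⟨ *-monoˡ-≤ (n ^ 4) (*-monoʳ-≤ s (*-monoʳ-≤ s (<⇒≤ (≰⇒> (minimal refl))))) ⟩
    s * (s * (32 * u * n ^ j)) * n ^ 4
      ≡⟨ regroup s u n (n ^ j) ⟩
    s * s * (32 * n) * u * (n * (n * (n * n ^ j)))
      ≤⟨ *-monoˡ-≤ (n * (n * (n * n ^ j))) (*-monoˡ-≤ u (*-mono-≤ (*-mono-≤ s≤u s≤u) (≤-trans 32n≤s s≤u))) ⟩
    u * u * u * u * (n * (n * (n * n ^ j)))
      ≡⟨ cong (_* (n * (n * (n * n ^ j)))) (fourth u) ⟩
    u ^ 4 * n ^ (3 + j) ∎)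
    where
    regroup : ∀ s u n p → s * (s * (32 * u * p)) * (n * (n * (n * (n * 1)))) ≡ s * s * (32 * n) * u * (n * (n * (n * p)))
    regroup = solve-∀
    fourth : ∀ u → u * u * u * u ≡ u * (u * (u * (u * 1)))
    fourth = solve-∀

-- For `u = 1` the logarithm is zero and cells must have zero bits; the only possible pair is known
-- in advance.
singleton-dictionary : ∀ s → NonAdaptiveDictionary 1 1 s 0 0
singleton-dictionary s = record
  { store   = λ _ → Vec.replicate s []
  ; probes  = λ _ → []
  ; answer  = λ _ _ → just zero
  ; correct = λ { X zero → only (pairs X) (size X) }
  }
  where
  only : ∀ (p : Subset 1) → ∣ p ∣ ≡ 1 → zero ∈ˢ p
  only (true ∷ []) _ = here

-- The ratio of logarithms is zero for `u = n`, where a probe may still be needed; the alternative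
-- `t ≤ 1` covers this and every case `u ≤ s`.
theorem1 : ∃[ c₀ ] ∃[ c₁ ] ∃[ c₂ ] ∃[ C ]
    (∀ (n u s : ℕ) → 1 ≤ n → n ≤ u → c₀ * n ≤ s →
    ∃[ w ] ∃[ t ]
    (lg[ u / 1 ] ≼ fromℕ (c₁ * w)) ×
    (fromℕ w ≼ c₂ · lg[ u / 1 ]) ×
    (t ≤ 1 ⊎ fromℕ t ≼ C · (lg[ u / n ] ÷ lg[ s / n ])) ×
    NonAdaptiveDictionary n u s w t)
theorem1 = 32 , 1 , 4 , 4 , construct
  where
  construct : ∀ n u s → 1 ≤ n → n ≤ u → 32 * n ≤ s →
    ∃[ w ] ∃[ t ]
    (lg[ u / 1 ] ≼ fromℕ (1 * w)) ×
    (fromℕ w ≼ 4 · lg[ u / 1 ]) ×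
    (t ≤ 1 ⊎ fromℕ t ≼ 4 · (lg[ u / n ] ÷ lg[ s / n ])) ×
    NonAdaptiveDictionary n u s w t
  construct 1 1 s _ _ _ =
    0 , 0 , lg≼fromℕ 0 ≤-refl z≤n , fromℕ≼·lg 0 ≤-refl z≤n , inj₁ z≤n , singleton-dictionary s
  construct (suc (suc _)) 1 s _ (s≤s ()) _
  construct n@(suc _) u@(suc (suc _)) s 1≤n n≤u 32n≤s with ⌊lg⌋ u (s≤s z≤n)
  ... | zero  , _ , s≤s (s≤s ())
  ... | suc L , 2^L≤u , u<2^1+L =
    let t , fast , dict = by-size (≤-total u s) in
    w , t , lg≼fromℕ (2 + L) (<⇒≤ u<2^1+L) (≤-trans (m≤m+n (2 + L) (2 + L)) (m≤m+n w 0))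
          , fromℕ≼·lg (suc L) 2^L≤u w≤4[1+L] , fast , dict
    where
    -- Since `u < 2 ^ (2 + L)`, twice `2 + L` bits hold a pair and leave a code for the empty cell.
    w = (2 + L) + (2 + L)

    w≤4[1+L] : w ≤ 4 * suc L
    w≤4[1+L] = ≤-trans (m≤m+n w (L + L)) (≤-reflexive (lem L))
      where
      lem : ∀ L → (2 + L) + (2 + L) + (L + L) ≡ 4 * suc L
      lem = solve-∀

    u*u<2^w : u * u < 2 ^ w
    u*u<2^w = subst (u * u <_) (sym (^-distribˡ-+-* 2 (2 + L) (2 + L))) (*-mono-< u<2^1+L u<2^1+L)

    by-size : u ≤ s ⊎ s ≤ u → ∃[ t ]
      (t ≤ 1 ⊎ fromℕ t ≼ 4 · (lg[ u / n ] ÷ lg[ s / n ])) × NonAdaptiveDictionary n u s w t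
    by-size (inj₁ u≤s) = 1 , inj₁ ≤-refl , dictionary u*u<2^w _ (direct-Assignable n u≤s)
    by-size (inj₂ s≤u) =
      let r , enough , fast = probe-count n u s 1≤n 32n≤s s≤u
          n≤s               = ≤-trans (m≤n*m n 32) 32n≤s
          f , expands       = expander n u s r ⦃ >-nonZero (≤-trans 1≤n n≤s) ⦄ enough n≤s
      in 2 + r , inj₂ (fromℕ≼·lg÷lg 4 fast) , dictionary u*u<2^w f (expander⇒Assignable f expands)
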